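{- Let $\mathcal{T}=(t_n)_{n=0}^\infty$ be the Thue-Morse sequence over $\mathbb{F}_2$. For every $N=1,2,\ldots$, the $N$th expansion complexity $E(\mathcal{T},N)$ of $\mathcal{T}$ is at most $5$.
   Context: The Thue-Morse sequence $\mathcal{T}=(t_n)_{n=0}^\infty$ over $\mathbb{F}_2=\{0,1\}$ is defined by $t_0=0$ and, for $n\ge 1$, $t_n=t_{n/2}$ if $n$ is even and $t_n=t_{(n-1)/2}+1$ (addition in $\mathbb{F}_2$) if $n$ is odd. For a binary sequence $\mathcal{S}=(s_n)_{n=0}^\infty$ with $s_n\in\mathbb{F}_2$, let $G(x)=\sum_{n=0}^\infty s_nx^n\in\mathbb{F}_2[[x]]$ be its generating function. For $N\ge 1$, if $(s_0,\ldots,s_{N-1})\neq(0,\ldots,0)$, the $N$th expansion complexity $E(\mathcal{S},N)$ is the smallest (total) degree of a nonzero polynomial $h(x,y)\in\mathbb{F}_2[x,y]$ with $h(x,G(x))\equiv 0 \bmod x^N$. If $(s_0,\ldots,s_{N-1})=(0,\ldots,0)$, one sets $E(\mathcal{S},N)=0$. -}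

module Defs where

open import Data.Nat.Base as ℕ using (ℕ; zero; suc; _∸_; _≤_; _<_; z≤n; s≤s; parity; ⌊_/2⌋)
import Data.Nat.Properties as ℕₚ
open import Data.Nat.Induction using (<-wellFounded)
open import Induction.WellFounded using (Acc; acc)
open import Data.Parity.Base as ℙ using (Parity; 0ℙ; 1ℙ)
import Data.Parity.Properties as ℙₚ
open import Algebra.Properties.CommutativeMonoid.Sum ℙₚ.+-0-commutativeMonoid
  using (sum⁺-syntax; sum-cong-≗; sum-replicate-zero)
open import Data.Fin.Base using (toℕ)
open import Data.List.Base using (List; []; _∷_; length; applyUpTo; cartesianProductWith; replicate; _++_)
open import Data.List.Membership.Propositional using (_∈_; lose)
open import Data.List.Membership.Propositional.Properties using (∈-cartesianProductWith⁺)
open import Data.List.Relation.Unary.Any using (Any; here; there; any?; satisfied)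
open import Data.Product using (∃; ∃₂; _×_; _,_; proj₁; proj₂)
open import Relation.Nullary using (¬_; Dec; yes; no; contradiction; ¬?)
open import Relation.Nullary.Decidable using (map′; _×-dec_; decidable-stable)
open import Relation.Binary.PropositionalEquality
  using (_≡_; _≢_; _≗_; refl; sym; trans; cong; cong₂; subst)

-- The field with two elements, as the ring of parities.
𝔽₂ : Set
𝔽₂ = Parity

Sequence : Set
Sequence = ℕ → 𝔽₂

private
  thueMorse-acc : ∀ n → Acc _<_ n → 𝔽₂
  thueMorse-acc zero      _        = 0ℙ
  thueMorse-acc n@(suc m) (acc rs) with parity n
  ... | 0ℙ = thueMorse-acc ⌊ n /2⌋ (rs (ℕₚ.⌊n/2⌋<n m))
  ... | 1ℙ = thueMorse-acc ⌊ m /2⌋ (rs (s≤s (ℕₚ.⌊n/2⌋≤n m))) ℙ.+ 1ℙ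

  thueMorse-irr : ∀ n (p q : Acc _<_ n) → thueMorse-acc n p ≡ thueMorse-acc n q
  thueMorse-irr zero      _        _        = refl
  thueMorse-irr n@(suc m) (acc rs) (acc ss) with parity n
  ... | 0ℙ = thueMorse-irr ⌊ n /2⌋ _ _
  ... | 1ℙ = cong (ℙ._+ 1ℙ) (thueMorse-irr ⌊ m /2⌋ _ _)

thueMorse : Sequence
thueMorse n = thueMorse-acc n (<-wellFounded n)

thueMorse-zero : thueMorse 0 ≡ 0ℙ
thueMorse-zero = refl

private
  parity-2* : ∀ n → parity (n ℕ.+ n) ≡ 0ℙ
  parity-2* zero    = refl
  parity-2* (suc n) rewrite ℕₚ.+-suc n n = parity-2* n

  parity-1+2* : ∀ n → parity (suc (n ℕ.+ n)) ≡ 1ℙ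
  parity-1+2* zero    = refl
  parity-1+2* (suc n) rewrite ℕₚ.+-suc n n = parity-1+2* n

  thueMorse-acc-even : ∀ n p k → n ≡ k ℕ.+ k → thueMorse-acc n p ≡ thueMorse k
  thueMorse-acc-even zero      p        zero    eq = refl
  thueMorse-acc-even n@(suc m) (acc rs) k       eq
    with parity n | trans (cong parity eq) (parity-2* k)
       | trans (cong ⌊_/2⌋ eq) (sym (ℕₚ.n≡⌊n+n/2⌋ k))
  ... | 0ℙ | _ | refl = thueMorse-irr ⌊ n /2⌋ _ _

  thueMorse-acc-odd : ∀ n p k → n ≡ suc (k ℕ.+ k) →
                      thueMorse-acc n p ≡ thueMorse k ℙ.+ 1ℙ
  thueMorse-acc-odd n@(suc m) (acc rs) k eq
    with parity n | trans (cong parity eq) (parity-1+2* k)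
       | trans (cong ⌊_/2⌋ (ℕₚ.suc-injective eq)) (sym (ℕₚ.n≡⌊n+n/2⌋ k))
  ... | 1ℙ | _ | refl = cong (ℙ._+ 1ℙ) (thueMorse-irr ⌊ m /2⌋ _ _)

thueMorse-even : ∀ k → thueMorse (k ℕ.+ k) ≡ thueMorse k
thueMorse-even k = thueMorse-acc-even _ _ k refl

thueMorse-odd : ∀ k → thueMorse (suc (k ℕ.+ k)) ≡ thueMorse k ℙ.+ 1ℙ
thueMorse-odd k = thueMorse-acc-odd _ _ k refl

-- The power series ring 𝔽₂[[x]]: a series is its function of coefficients.

𝔽₂⟦x⟧ : Set
𝔽₂⟦x⟧ = ℕ → 𝔽₂

infixl 6 _⊕_
infixl 7 _⊗_

0ₛ : 𝔽₂⟦x⟧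
0ₛ _ = 0ℙ

_⊕_ : 𝔽₂⟦x⟧ → 𝔽₂⟦x⟧ → 𝔽₂⟦x⟧
(f ⊕ g) n = f n ℙ.+ g n

_⊗_ : 𝔽₂⟦x⟧ → 𝔽₂⟦x⟧ → 𝔽₂⟦x⟧
(f ⊗ g) n = ∑[ k ≤ n ] (f (toℕ k) ℙ.* g (n ∸ toℕ k))

generatingFunction : Sequence → 𝔽₂⟦x⟧
generatingFunction s n = s n

infix 4 _≡0mod-x^_

_≡0mod-x^_ : 𝔽₂⟦x⟧ → ℕ → Set
f ≡0mod-x^ N = ∀ {n} → n < N → f n ≡ 0ℙ

-- Polynomials are coefficient lists, lowest degree first.  Trailing zeros are
-- allowed, so being nonzero and the degree are defined through coefficients.

𝔽₂[x] : Set
𝔽₂[x] = List 𝔽₂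

𝔽₂[x,y] : Set
𝔽₂[x,y] = List 𝔽₂[x]

lookupOr : ∀ {A : Set} → A → List A → ℕ → A
lookupOr a []       _       = a
lookupOr a (x ∷ xs) zero    = x
lookupOr a (x ∷ xs) (suc n) = lookupOr a xs n

-- coeff h i j is the coefficient of xⁱ yʲ.
coeff : 𝔽₂[x,y] → ℕ → ℕ → 𝔽₂
coeff h i j = lookupOr 0ℙ (lookupOr [] h j) i

NonZeroPoly : 𝔽₂[x,y] → Set
NonZeroPoly h = ∃₂ λ i j → coeff h i j ≢ 0ℙ

record HasTotalDegree (h : 𝔽₂[x,y]) (d : ℕ) : Set where
  constructor _,_
  field
    attained : ∃₂ λ i j → coeff h i j ≢ 0ℙ × i ℕ.+ j ≡ d
    bounded  : ∀ i j → coeff h i j ≢ 0ℙ → i ℕ.+ j ≤ d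

toSeries : 𝔽₂[x] → 𝔽₂⟦x⟧
toSeries p = lookupOr 0ℙ p

-- h(x, G(x)), by Horner's rule in y.
eval : 𝔽₂[x,y] → 𝔽₂⟦x⟧ → 𝔽₂⟦x⟧
eval []      G = 0ₛ
eval (p ∷ h) G = toSeries p ⊕ G ⊗ eval h G

AnnihilatedInDegree : Sequence → ℕ → ℕ → Set
AnnihilatedInDegree s N d = ∃ λ h →
  NonZeroPoly h × HasTotalDegree h d × eval h (generatingFunction s) ≡0mod-x^ N

ZeroPrefix : Sequence → ℕ → Set
ZeroPrefix s N = ∀ {n} → n < N → s n ≡ 0ℙ

record IsLeast (P : ℕ → Set) (m : ℕ) : Set where
  constructor _,_
  field
    holds   : P m
    minimal : ∀ {k} → P k → m ≤ k

record IsExpansionComplexity (s : Sequence) (N e : ℕ) : Set where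
  field
    zeroPrefix    : ZeroPrefix s N → e ≡ 0
    nonZeroPrefix : ¬ ZeroPrefix s N → IsLeast (AnnihilatedInDegree s N) e

-- Existence of the minimum: x^N is always admissible, and admissibility in a
-- given degree is decided by a finite search.

private
  least : ∀ {P : ℕ → Set} → (∀ n → Dec (P n)) → ∀ n → P n → ∃ (IsLeast P)
  least P? zero    p = 0 , (p , λ _ → z≤n)
  least {P} P? (suc n) p with P? 0
  ... | yes p₀ = 0 , (p₀ , λ _ → z≤n)
  ... | no ¬p₀ with least (λ k → P? (suc k)) n p
  ...   | m , (pm , min) = suc m , (pm , min′)
    where
    min′ : ∀ {k} → P k → suc m ≤ k
    min′ {zero}  q = contradiction q ¬p₀
    min′ {suc k} q = s≤s (min q)

  lookupOr-≥ : ∀ {A : Set} (a : A) xs {i} → length xs ≤ i → lookupOr a xs i ≡ a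
  lookupOr-≥ a []       _         = refl
  lookupOr-≥ a (x ∷ xs) (s≤s len) = lookupOr-≥ a xs len

  coeff-<ʸ : ∀ h i j → coeff h i j ≢ 0ℙ → j < length h
  coeff-<ʸ h i j c≢0 = ℕₚ.≰⇒> λ len≤j →
    c≢0 (cong (λ p → lookupOr 0ℙ p i) (lookupOr-≥ [] h len≤j))

  coeff-<ˣ : ∀ h i j → coeff h i j ≢ 0ℙ → i < length (lookupOr [] h j)
  coeff-<ˣ h i j c≢0 = ℕₚ.≰⇒> λ len≤i → c≢0 (lookupOr-≥ 0ℙ (lookupOr [] h j) len≤i)

  anyCoeff? : ∀ {R : ℕ → ℕ → Set} → (∀ i j → Dec (R i j)) →
              ∀ h → Dec (∃₂ λ i j → coeff h i j ≢ 0ℙ × R i j)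
  anyCoeff? R? h = map′
    (λ { (j , _ , i , _ , c , r) → i , j , c , r })
    (λ { (i , j , c , r) → j , coeff-<ʸ h i j c , i , coeff-<ˣ h i j c , c , r })
    (ℕₚ.anyUpTo? (λ j → ℕₚ.anyUpTo?
      (λ i → ¬? (coeff h i j ℙₚ.≟ 0ℙ) ×-dec R? i j) (length (lookupOr [] h j))) (length h))

  hasTotalDegree? : ∀ h d → Dec (HasTotalDegree h d)
  hasTotalDegree? h d = map′
    (λ { (a , ¬b) → a , λ i j c → decidable-stable (i ℕ.+ j ℕₚ.≤? d) λ i+j≰d → ¬b (i , j , c , i+j≰d) })
    (λ { (a , b) → a , λ { (i , j , c , i+j≰d) → i+j≰d (b i j c) } })
    (anyCoeff? (λ i j → i ℕ.+ j ℕₚ.≟ d) h ×-dec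
     ¬? (anyCoeff? (λ i j → ¬? (i ℕ.+ j ℕₚ.≤? d)) h))

  nonZero : ∀ {h d} → HasTotalDegree h d → NonZeroPoly h
  nonZero ((i , j , c , _) , _) = i , j , c

  ⊗-cong : ∀ {f f′ g g′} → f ≗ f′ → g ≗ g′ → f ⊗ g ≗ f′ ⊗ g′
  ⊗-cong f≗f′ g≗g′ n = sum-cong-≗ {suc n} λ k → cong₂ ℙ._*_ (f≗f′ (toℕ k)) (g≗g′ (n ∸ toℕ k))

  ⊗-zeroʳ : ∀ f → f ⊗ 0ₛ ≗ 0ₛ
  ⊗-zeroʳ f n = trans (sum-cong-≗ {suc n} λ k → ℙₚ.*-zeroʳ (f (toℕ k))) (sum-replicate-zero (suc n))

  eval-zero : ∀ h G → (∀ i j → coeff h i j ≡ 0ℙ) → eval h G ≗ 0ₛ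
  eval-zero []      G eq n = refl
  eval-zero (p ∷ h) G eq n = cong₂ ℙ._+_ (eq n 0)
    (trans (⊗-cong {f = G} (λ _ → refl) (eval-zero h G λ i j → eq i (suc j)) n) (⊗-zeroʳ G n))

  eval-cong : ∀ h h′ G → (∀ i j → coeff h i j ≡ coeff h′ i j) → eval h G ≗ eval h′ G
  eval-cong []      h′        G eq n = sym (eval-zero h′ G (λ i j → sym (eq i j)) n)
  eval-cong (p ∷ h) []        G eq n = eval-zero (p ∷ h) G eq n
  eval-cong (p ∷ h) (p′ ∷ h′) G eq n = cong₂ ℙ._+_ (eq n 0)
    (⊗-cong {f = G} (λ _ → refl) (eval-cong h h′ G λ i j → eq i (suc j)) n)

  hasTotalDegree-cong : ∀ {h h′ d} → (∀ i j → coeff h i j ≡ coeff h′ i j) →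
                        HasTotalDegree h d → HasTotalDegree h′ d
  hasTotalDegree-cong eq ((i , j , c , i+j≡d) , b) =
    (i , j , (λ c≡0 → c (trans (eq i j) c≡0)) , i+j≡d) ,
    λ i j c → b i j λ c≡0 → c (trans (sym (eq i j)) c≡0)

  lookupOr-applyUpTo-< : ∀ {A : Set} (a : A) f n {i} → i < n → lookupOr a (applyUpTo f n) i ≡ f i
  lookupOr-applyUpTo-< a f (suc n) {zero}  _         = refl
  lookupOr-applyUpTo-< a f (suc n) {suc i} (s≤s i<n) = lookupOr-applyUpTo-< a (λ k → f (suc k)) n i<n

  lookupOr-applyUpTo-≥ : ∀ {A : Set} (a : A) f n {i} → n ≤ i → lookupOr a (applyUpTo f n) i ≡ a
  lookupOr-applyUpTo-≥ a f zero    _         = refl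
  lookupOr-applyUpTo-≥ a f (suc n) (s≤s n≤i) = lookupOr-applyUpTo-≥ a (λ k → f (suc k)) n n≤i

  listsOver : ∀ {A : Set} → List A → ℕ → List (List A)
  listsOver as zero    = [] ∷ []
  listsOver as (suc n) = cartesianProductWith _∷_ as (listsOver as n)

  ∈-listsOver : ∀ {A : Set} (as : List A) f n → (∀ i → f i ∈ as) → applyUpTo f n ∈ listsOver as n
  ∈-listsOver as f zero    f∈ = here refl
  ∈-listsOver as f (suc n) f∈ =
    ∈-cartesianProductWith⁺ _∷_ (f∈ 0) (∈-listsOver as (λ k → f (suc k)) n (λ i → f∈ (suc i)))

  candidates : ℕ → List 𝔽₂[x,y]
  candidates d = listsOver (listsOver (0ℙ ∷ 1ℙ ∷ []) (suc d)) (suc d)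

  row : ℕ → 𝔽₂[x,y] → ℕ → 𝔽₂[x]
  row d h j = applyUpTo (λ i → coeff h i j) (suc d)

  normalise : ℕ → 𝔽₂[x,y] → 𝔽₂[x,y]
  normalise d h = applyUpTo (row d h) (suc d)

  normalise∈candidates : ∀ d h → normalise d h ∈ candidates d
  normalise∈candidates d h = ∈-listsOver _ _ (suc d) λ j → ∈-listsOver _ _ (suc d) λ i → ∈-𝔽₂ (coeff h i j)
    where
    ∈-𝔽₂ : ∀ a → a ∈ 0ℙ ∷ 1ℙ ∷ []
    ∈-𝔽₂ 0ℙ = here refl
    ∈-𝔽₂ 1ℙ = there (here refl)

  coeff-normalise : ∀ {d h} → HasTotalDegree h d → ∀ i j → coeff h i j ≡ coeff (normalise d h) i j
  coeff-normalise {d} {h} (_ , b) i j with j ℕₚ.≤? d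
  ... | no j≰d = trans
    (decidable-stable (coeff h i j ℙₚ.≟ 0ℙ) λ c → j≰d (ℕₚ.≤-trans (ℕₚ.m≤n+m j i) (b i j c)))
    (sym (cong (λ p → lookupOr 0ℙ p i) (lookupOr-applyUpTo-≥ [] (row d h) (suc d) (ℕₚ.≰⇒> j≰d))))
  ... | yes j≤d = trans inner
    (sym (cong (λ p → lookupOr 0ℙ p i) (lookupOr-applyUpTo-< [] (row d h) (suc d) (s≤s j≤d))))
    where
    inner : coeff h i j ≡ lookupOr 0ℙ (row d h j) i
    inner with i ℕₚ.≤? d
    ... | yes i≤d = sym (lookupOr-applyUpTo-< 0ℙ (λ i → coeff h i j) (suc d) (s≤s i≤d))
    ... | no  i≰d = trans
      (decidable-stable (coeff h i j ℙₚ.≟ 0ℙ) λ c → i≰d (ℕₚ.≤-trans (ℕₚ.m≤m+n i j) (b i j c)))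
      (sym (lookupOr-applyUpTo-≥ 0ℙ (λ i → coeff h i j) (suc d) (ℕₚ.≰⇒> i≰d)))

  annihilatedInDegree? : ∀ s N d → Dec (AnnihilatedInDegree s N d)
  annihilatedInDegree? s N d = map′ to from (any? Q? (candidates d))
    where
    G = generatingFunction s

    Q : 𝔽₂[x,y] → Set
    Q h = HasTotalDegree h d × eval h G ≡0mod-x^ N

    Q? : ∀ h → Dec (Q h)
    Q? h = hasTotalDegree? h d ×-dec ℕₚ.allUpTo? (λ n → eval h G n ℙₚ.≟ 0ℙ) N

    to : Any Q (candidates d) → AnnihilatedInDegree s N d
    to found with satisfied found
    ... | h , deg , ann = h , nonZero deg , deg , ann

    from : AnnihilatedInDegree s N d → Any Q (candidates d)
    from (h , _ , deg , ann) = lose {P = Q} (normalise∈candidates d h)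
      (hasTotalDegree-cong eq deg ,
       λ {n} n<N → trans (sym (eval-cong h (normalise d h) G eq n)) (ann n<N))
      where
      eq : ∀ i j → coeff h i j ≡ coeff (normalise d h) i j
      eq = coeff-normalise deg

  xPower : ℕ → 𝔽₂[x]
  xPower N = replicate N 0ℙ ++ 1ℙ ∷ []

  xPower-≡ : ∀ N → lookupOr 0ℙ (xPower N) N ≡ 1ℙ
  xPower-≡ zero    = refl
  xPower-≡ (suc N) = xPower-≡ N

  xPower-≢ : ∀ N i → i ≢ N → lookupOr 0ℙ (xPower N) i ≡ 0ℙ
  xPower-≢ zero    zero    i≢N = contradiction refl i≢N
  xPower-≢ zero    (suc i) i≢N = refl
  xPower-≢ (suc N) zero    i≢N = refl
  xPower-≢ (suc N) (suc i) i≢N = xPower-≢ N i λ i≡N → i≢N (cong suc i≡N)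

  annihilatedByxPower : ∀ s N → AnnihilatedInDegree s N N
  annihilatedByxPower s N = h , nonZero deg , deg , ann
    where
    h : 𝔽₂[x,y]
    h = xPower N ∷ []

    N≢0 : coeff h N 0 ≢ 0ℙ
    N≢0 eq with trans (sym (xPower-≡ N)) eq
    ... | ()

    bound : ∀ i j → coeff h i j ≢ 0ℙ → i ℕ.+ j ≤ N
    bound i zero c = ℕₚ.≤-reflexive (trans (ℕₚ.+-identityʳ i)
      (decidable-stable (i ℕₚ.≟ N) λ i≢N → c (xPower-≢ N i i≢N)))
    bound i (suc j) c = contradiction refl c

    deg : HasTotalDegree h N
    deg = (N , 0 , N≢0 , ℕₚ.+-identityʳ N) , bound

    ann : eval h (generatingFunction s) ≡0mod-x^ N
    ann {n} n<N = cong₂ ℙ._+_ (xPower-≢ N n (ℕₚ.<⇒≢ n<N)) (⊗-zeroʳ s n)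

∃-expansionComplexity : ∀ s N → ∃ (IsExpansionComplexity s N)
∃-expansionComplexity s N with ℕₚ.allUpTo? (λ n → s n ℙₚ.≟ 0ℙ) N
... | yes zs = 0 , record
  { zeroPrefix = λ _ → refl ; nonZeroPrefix = λ ¬zs → contradiction (λ {n} → zs {n}) ¬zs }
... | no ¬zs with least (annihilatedInDegree? s N) N (annihilatedByxPower s N)
...   | e , isLeast = e , record
  { zeroPrefix = λ zs → contradiction (λ {n} → zs {n}) ¬zs ; nonZeroPrefix = λ _ → isLeast }

expansionComplexity : Sequence → ℕ → ℕ
expansionComplexity s N = proj₁ (∃-expansionComplexity s N)

isExpansionComplexity : ∀ s N → IsExpansionComplexity s N (expansionComplexity s N)
isExpansionComplexity s N = proj₂ (∃-expansionComplexity s N)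

{-# OPTIONS --safe #-}

-- The generating function G of the Thue-Morse sequence is a root of
-- x + (1+x)² y + (1+x)³ y², a polynomial of total degree 5.  Squaring over 𝔽₂
-- spreads the coefficients out, G² = G(x²), so t₂ₖ = tₖ and t₂ₖ₊₁ = tₖ + 1 say
-- that G + (1+x) G² has n-th coefficient n mod 2, i.e. equals x / (1+x)².
module Submission where

open import Defs
open import Data.Nat using (ℕ; _≤_)
open import Data.Nat.Base as ℕ using (zero; suc; z≤n; s≤s; parity)
import Data.Nat.Properties as ℕₚ
-- The library gives _+_ and _*_ on Parity the same precedence.
open import Data.Parity.Base using (0ℙ; 1ℙ; _⁻¹; _*_) renaming (_+_ to infixl 6 _+_)
import Data.Parity.Properties as ℙₚ
open import Algebra.Properties.Semiring.Sum ℙₚ.+-*-semiring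
  using (∑-distrib-+; *-distribˡ-sum; sum-cong-≗; sum-replicate-zero)
open import Algebra.Properties.CommutativeSemigroup ℙₚ.+-commutativeSemigroup
  using (interchange)
open import Data.Fin.Base using (toℕ)
open import Data.List.Base using ([]; _∷_)
open import Data.Product using (_,_)
open import Function.Base using (_∘_; case_of_)
open import Relation.Nullary using (yes; no; contradiction)
open import Relation.Binary.PropositionalEquality
  using (_≡_; _≢_; _≗_; refl; sym; trans; cong; cong₂; subst; module ≡-Reasoning)

-- By definition `(f ⊗ g) (suc n)` unfolds to `f 0 * g (suc n) + (tail f ⊗ g) n`; the inductions on
-- products rest on this recursion.
tail : 𝔽₂⟦x⟧ → 𝔽₂⟦x⟧
tail f = f ∘ suc

⊗-congʳ : ∀ f {g g′} → g ≗ g′ → f ⊗ g ≗ f ⊗ g′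
⊗-congʳ f g≗g′ n = sum-cong-≗ {suc n} λ k → cong (f (toℕ k) *_) (g≗g′ (n ℕ.∸ toℕ k))

⊗-zeroˡ : ∀ f → 0ₛ ⊗ f ≗ 0ₛ
⊗-zeroˡ f n = sum-replicate-zero (suc n)

⊗-distribˡ-⊕ : ∀ f g h → f ⊗ (g ⊕ h) ≗ f ⊗ g ⊕ f ⊗ h
⊗-distribˡ-⊕ f g h n = trans
  (sum-cong-≗ {suc n} λ k → ℙₚ.*-distribˡ-+ (f (toℕ k)) (g (n ℕ.∸ toℕ k)) (h (n ℕ.∸ toℕ k)))
  (∑-distrib-+ {suc n} (λ k → f (toℕ k) * g (n ℕ.∸ toℕ k)) (λ k → f (toℕ k) * h (n ℕ.∸ toℕ k)))

⊗-distribʳ-⊕ : ∀ f g h → (g ⊕ h) ⊗ f ≗ g ⊗ f ⊕ h ⊗ f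
⊗-distribʳ-⊕ f g h n = trans
  (sum-cong-≗ {suc n} λ k → ℙₚ.*-distribʳ-+ (f (n ℕ.∸ toℕ k)) (g (toℕ k)) (h (toℕ k)))
  (∑-distrib-+ {suc n} (λ k → g (toℕ k) * f (n ℕ.∸ toℕ k)) (λ k → h (toℕ k) * f (n ℕ.∸ toℕ k)))

⊗-scaleˡ : ∀ c f g n → ((λ k → c * f k) ⊗ g) n ≡ c * (f ⊗ g) n
⊗-scaleˡ c f g n = trans
  (sum-cong-≗ {suc n} λ k → ℙₚ.*-assoc c (f (toℕ k)) (g (n ℕ.∸ toℕ k)))
  (sym (*-distribˡ-sum {suc n} c (λ k → f (toℕ k) * g (n ℕ.∸ toℕ k))))

-- Mirror image of the definitional recursion: the convolution sum is split at its last term instead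
-- of its first.
⊗-last : ∀ f g n → (f ⊗ g) (suc n) ≡ (f ⊗ tail g) n + f (suc n) * g 0
⊗-last f g zero    = sym (trans (ℙₚ.+-assoc (f 0 * g 1) 0ℙ (f 1 * g 0))
  (cong (f 0 * g 1 +_) (sym (ℙₚ.+-identityʳ (f 1 * g 0)))))
⊗-last f g (suc n) = trans
  (cong (f 0 * g (2 ℕ.+ n) +_) (⊗-last (tail f) g n))
  (sym (ℙₚ.+-assoc (f 0 * g (2 ℕ.+ n)) ((tail f ⊗ tail g) n) (f (2 ℕ.+ n) * g 0)))

⊗-comm : ∀ f g → f ⊗ g ≗ g ⊗ f
⊗-comm f g zero    = cong (_+ 0ℙ) (ℙₚ.*-comm (f 0) (g 0))
⊗-comm f g (suc n) = begin
  (f ⊗ g) (suc n)                          ≡⟨ ⊗-last f g n ⟩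
  (f ⊗ tail g) n + f (suc n) * g 0     ≡⟨ cong₂ _+_ (⊗-comm f (tail g) n) (ℙₚ.*-comm (f (suc n)) (g 0)) ⟩
  (tail g ⊗ f) n + g 0 * f (suc n)     ≡⟨ ℙₚ.+-comm ((tail g ⊗ f) n) (g 0 * f (suc n)) ⟩
  (g ⊗ f) (suc n)                          ∎
  where open ≡-Reasoning

-- The tail of `f ⊗ g` is `f 0` times `tail g` plus `tail f ⊗ g`, so the induction on the index
-- continues with `tail f` for `f`.
⊗-assoc : ∀ f g h → (f ⊗ g) ⊗ h ≗ f ⊗ (g ⊗ h)
⊗-assoc f g h zero
  rewrite ℙₚ.+-identityʳ (f 0 * g 0) | ℙₚ.+-identityʳ (g 0 * h 0)
  = cong (_+ 0ℙ) (ℙₚ.*-assoc (f 0) (g 0) (h 0))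
⊗-assoc f g h (suc n) = begin
  (f 0 * g 0 + 0ℙ) * h (suc n) + (((λ k → f 0 * tail g k) ⊕ tail f ⊗ g) ⊗ h) n
    ≡⟨ cong₂ _+_
         (trans (cong (_* h (suc n)) (ℙₚ.+-identityʳ (f 0 * g 0))) (ℙₚ.*-assoc (f 0) (g 0) (h (suc n))))
         (trans (⊗-distribʳ-⊕ h (λ k → f 0 * tail g k) (tail f ⊗ g) n)
                (cong₂ _+_ (⊗-scaleˡ (f 0) (tail g) h n) (⊗-assoc (tail f) g h n))) ⟩
  f 0 * (g 0 * h (suc n)) + (f 0 * (tail g ⊗ h) n + (tail f ⊗ (g ⊗ h)) n)
    ≡⟨ ℙₚ.+-assoc (f 0 * (g 0 * h (suc n))) (f 0 * (tail g ⊗ h) n) ((tail f ⊗ (g ⊗ h)) n) ⟨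
  f 0 * (g 0 * h (suc n)) + f 0 * (tail g ⊗ h) n + (tail f ⊗ (g ⊗ h)) n
    ≡⟨ cong (_+ (tail f ⊗ (g ⊗ h)) n) (ℙₚ.*-distribˡ-+ (f 0) (g 0 * h (suc n)) ((tail g ⊗ h) n)) ⟨
  (f ⊗ (g ⊗ h)) (suc n) ∎
  where open ≡-Reasoning

toSeries-1-⊗ : ∀ f → toSeries (1ℙ ∷ []) ⊗ f ≗ f
toSeries-1-⊗ f zero    = ℙₚ.+-identityʳ (f 0)
toSeries-1-⊗ f (suc n) = trans (cong (f (suc n) +_) (⊗-zeroˡ f n)) (ℙₚ.+-identityʳ (f (suc n)))

-- Moves the coefficient polynomials out of the Horner nesting to the left, where products unfold
-- along their finitely many coefficients.
eval-quadratic : ∀ p q r G →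
  eval (p ∷ q ∷ r ∷ []) G ≗ toSeries p ⊕ (toSeries q ⊗ G ⊕ toSeries r ⊗ (G ⊗ G))
eval-quadratic p q r G n = cong (toSeries p n +_) (begin
  (G ⊗ (toSeries q ⊕ G ⊗ (toSeries r ⊕ G ⊗ 0ₛ))) n
    ≡⟨ ⊗-distribˡ-⊕ G (toSeries q) (G ⊗ (toSeries r ⊕ G ⊗ 0ₛ)) n ⟩
  (G ⊗ toSeries q) n + (G ⊗ (G ⊗ (toSeries r ⊕ G ⊗ 0ₛ))) n
    ≡⟨ cong₂ _+_ (⊗-comm G (toSeries q) n) (⊗-congʳ G (⊗-congʳ G r⊕G⊗0≗r) n) ⟩
  (toSeries q ⊗ G) n + (G ⊗ (G ⊗ toSeries r)) n
    ≡⟨ cong ((toSeries q ⊗ G) n +_) (trans (sym (⊗-assoc G G (toSeries r) n)) (⊗-comm (G ⊗ G) (toSeries r) n)) ⟩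
  (toSeries q ⊗ G) n + (toSeries r ⊗ (G ⊗ G)) n ∎)
  where
  open ≡-Reasoning
  r⊕G⊗0≗r : toSeries r ⊕ G ⊗ 0ₛ ≗ toSeries r
  r⊕G⊗0≗r k = trans (cong (toSeries r k +_) (trans (⊗-comm G 0ₛ k) (⊗-zeroˡ G k)))
    (ℙₚ.+-identityʳ (toSeries r k))

-- The two extreme terms f₀ fₙ₊₂ and fₙ₊₂ f₀ cancel.
square-step : ∀ f n → (f ⊗ f) (2 ℕ.+ n) ≡ (tail f ⊗ tail f) n
square-step f n = begin
  f 0 * f (2 ℕ.+ n) + (tail f ⊗ f) (suc n)
    ≡⟨ cong₂ _+_ (ℙₚ.*-comm (f 0) (f (2 ℕ.+ n)))
         (trans (⊗-last (tail f) f n) (ℙₚ.+-comm ((tail f ⊗ tail f) n) _)) ⟩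
  c + (c + (tail f ⊗ tail f) n)
    ≡⟨ ℙₚ.+-assoc c c _ ⟨
  (c + c) + (tail f ⊗ tail f) n
    ≡⟨ cong (_+ (tail f ⊗ tail f) n) (ℙₚ.p+p≡0ℙ c) ⟩
  (tail f ⊗ tail f) n ∎
  where
  open ≡-Reasoning
  c = f (2 ℕ.+ n) * f 0

-- Each `square-step` lowers the index by two and passes to the tail. Index 0 remains, with the
-- square of the k-th coefficient, and squaring is the identity on `𝔽₂`.
square-even : ∀ f k → (f ⊗ f) (k ℕ.+ k) ≡ f k
square-even f zero    = trans (ℙₚ.+-identityʳ (f 0 * f 0)) (ℙₚ.*-idem (f 0))
square-even f (suc k) rewrite ℕₚ.+-suc k k = trans (square-step f (k ℕ.+ k)) (square-even (tail f) k)

-- The same descent ends at index 1, where the two equal cross terms cancel.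
square-odd : ∀ f k → (f ⊗ f) (suc (k ℕ.+ k)) ≡ 0ℙ
square-odd f zero    = trans (⊗-last f f 0)
  (trans (cong₂ _+_ (ℙₚ.+-identityʳ (f 0 * f 1)) (ℙₚ.*-comm (f 1) (f 0))) (ℙₚ.p+p≡0ℙ (f 0 * f 1)))
square-odd f (suc k) rewrite ℕₚ.+-suc k k = trans (square-step f (suc (k ℕ.+ k))) (square-odd (tail f) k)

even-odd-elim : (P : ℕ → Set) → (∀ k → P (k ℕ.+ k)) → (∀ k → P (suc (k ℕ.+ k))) → ∀ n → P n
even-odd-elim P even odd zero          = even 0
even-odd-elim P even odd (suc zero)    = odd 0
even-odd-elim P even odd (suc (suc n)) = even-odd-elim (P ∘ suc ∘ suc)
  (λ k → subst (P ∘ suc) (ℕₚ.+-suc k k) (even (suc k)))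
  (λ k → subst (P ∘ suc ∘ suc) (ℕₚ.+-suc k k) (odd (suc k))) n

T : 𝔽₂⟦x⟧
T = generatingFunction thueMorse

-- Over `𝔽₂` the last two are (1+x)² and (1+x)³.
1+x 1+x² 1+x+x²+x³ : 𝔽₂[x]
1+x       = 1ℙ ∷ 1ℙ ∷ []
1+x²      = 1ℙ ∷ 0ℙ ∷ 1ℙ ∷ []
1+x+x²+x³ = 1ℙ ∷ 1ℙ ∷ 1ℙ ∷ 1ℙ ∷ []

parity-even : ∀ k → parity (k ℕ.+ k) ≡ 0ℙ
parity-even k = trans (ℙₚ.+-homo-+ k k) (ℙₚ.p+p≡0ℙ (parity k))

parity-odd : ∀ k → parity (suc (k ℕ.+ k)) ≡ 1ℙ
parity-odd k = trans (sym (ℙₚ.suc-homo-⁻¹ (suc (k ℕ.+ k)))) (cong _⁻¹ (parity-even k))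

1+x-⊗-suc : ∀ f n → (toSeries 1+x ⊗ f) (suc n) ≡ f (suc n) + f n
1+x-⊗-suc f n = cong (f (suc n) +_) (toSeries-1-⊗ f n)

-- As f² = f(x²) lives on even indices, the factor 1+x copies each coefficient to the next odd
-- index; here and in `1+x-⊗-square-odd` nothing overlaps.
1+x-⊗-square-even : ∀ f k → (toSeries 1+x ⊗ (f ⊗ f)) (k ℕ.+ k) ≡ f k
1+x-⊗-square-even f zero    = trans (ℙₚ.+-identityʳ ((f ⊗ f) 0)) (square-even f 0)
1+x-⊗-square-even f (suc k) rewrite ℕₚ.+-suc k k = begin
  (toSeries 1+x ⊗ (f ⊗ f)) (2 ℕ.+ (k ℕ.+ k))               ≡⟨ 1+x-⊗-suc (f ⊗ f) (suc (k ℕ.+ k)) ⟩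
  (f ⊗ f) (2 ℕ.+ (k ℕ.+ k)) + (f ⊗ f) (suc (k ℕ.+ k))      ≡⟨ cong₂ _+_ (square-step f (k ℕ.+ k)) (square-odd f k) ⟩
  (tail f ⊗ tail f) (k ℕ.+ k) + 0ℙ                         ≡⟨ ℙₚ.+-identityʳ _ ⟩
  (tail f ⊗ tail f) (k ℕ.+ k)                              ≡⟨ square-even (tail f) k ⟩
  f (suc k)                                                ∎
  where open ≡-Reasoning

1+x-⊗-square-odd : ∀ f k → (toSeries 1+x ⊗ (f ⊗ f)) (suc (k ℕ.+ k)) ≡ f k
1+x-⊗-square-odd f k =
  trans (1+x-⊗-suc (f ⊗ f) (k ℕ.+ k)) (cong₂ _+_ (square-odd f k) (square-even f k))

T⊕[1+x]T²≗parity : T ⊕ toSeries 1+x ⊗ (T ⊗ T) ≗ parity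
T⊕[1+x]T²≗parity = even-odd-elim _
  (λ k → begin
    T (k ℕ.+ k) + (toSeries 1+x ⊗ (T ⊗ T)) (k ℕ.+ k)   ≡⟨ cong₂ _+_ (thueMorse-even k) (1+x-⊗-square-even T k) ⟩
    T k + T k                                          ≡⟨ ℙₚ.p+p≡0ℙ (T k) ⟩
    0ℙ                                                 ≡⟨ parity-even k ⟨
    parity (k ℕ.+ k)                                   ∎)
  (λ k → begin
    T (suc (k ℕ.+ k)) + (toSeries 1+x ⊗ (T ⊗ T)) (suc (k ℕ.+ k))
      ≡⟨ cong₂ _+_ (thueMorse-odd k) (1+x-⊗-square-odd T k) ⟩
    T k + 1ℙ + T k            ≡⟨ cong (_+ T k) (ℙₚ.+-comm (T k) 1ℙ) ⟩
    1ℙ + T k + T k            ≡⟨ ℙₚ.+-assoc 1ℙ (T k) (T k) ⟩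
    1ℙ + (T k + T k)          ≡⟨ cong (1ℙ +_) (ℙₚ.p+p≡0ℙ (T k)) ⟩
    1ℙ                        ≡⟨ parity-odd k ⟨
    parity (suc (k ℕ.+ k))    ∎)
  where open ≡-Reasoning

-- Clears the denominator in y + (1+x) y² = x / (1+x)²; the rows are the coefficients of 1, y and
-- y².
annihilator : 𝔽₂[x,y]
annihilator = (0ℙ ∷ 1ℙ ∷ []) ∷ 1+x² ∷ 1+x+x²+x³ ∷ []

annihilator-T : eval annihilator T ≗ 0ₛ
annihilator-T n = trans (eval-quadratic (0ℙ ∷ 1ℙ ∷ []) 1+x² 1+x+x²+x³ T n) (vanishes n)
  where
  vanishes : toSeries (0ℙ ∷ 1ℙ ∷ []) ⊕ (toSeries 1+x² ⊗ T ⊕ toSeries 1+x+x²+x³ ⊗ (T ⊗ T)) ≗ 0ₛ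
  vanishes zero          = refl
  -- The term x of the annihilator cancels t₁ = 1.
  vanishes (suc zero)    = refl
  -- Since (1+x)³ = (1+x²)(1+x), the sum regroups as the equation for `parity` at 2+m plus the one
  -- at m, and `parity` has period two.
  vanishes (suc (suc m)) = begin
    T (2 ℕ.+ m) + (toSeries (1ℙ ∷ []) ⊗ T) m + (T² (2 ℕ.+ m) + (T² (1 ℕ.+ m) + (toSeries 1+x ⊗ T²) m))
      ≡⟨ cong₂ _+_ (cong (T (2 ℕ.+ m) +_) (toSeries-1-⊗ T m))
           (trans (sym (ℙₚ.+-assoc (T² (2 ℕ.+ m)) (T² (1 ℕ.+ m)) _))
                  (cong (_+ (toSeries 1+x ⊗ T²) m) (sym (1+x-⊗-suc T² (suc m))))) ⟩
    T (2 ℕ.+ m) + T m + ((toSeries 1+x ⊗ T²) (2 ℕ.+ m) + (toSeries 1+x ⊗ T²) m)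
      ≡⟨ interchange (T (2 ℕ.+ m)) (T m) _ _ ⟩
    T (2 ℕ.+ m) + (toSeries 1+x ⊗ T²) (2 ℕ.+ m) + (T m + (toSeries 1+x ⊗ T²) m)
      ≡⟨ cong₂ _+_ (T⊕[1+x]T²≗parity (2 ℕ.+ m)) (T⊕[1+x]T²≗parity m) ⟩
    parity m + parity m
      ≡⟨ ℙₚ.p+p≡0ℙ (parity m) ⟩
    0ℙ ∎
    where
    open ≡-Reasoning
    T² = T ⊗ T

-- The monomial x³y² has both the largest x-degree and the largest y-degree, so bounding these
-- separately gives exactly 5.
annihilator-degree : HasTotalDegree annihilator 5
annihilator-degree = (3 , 2 , (λ ()) , refl) , bounded
  where
  x-degree≤3 : ∀ i j → coeff annihilator i j ≢ 0ℙ → i ≤ 3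
  x-degree≤3 0 _ _ = z≤n
  x-degree≤3 1 _ _ = s≤s z≤n
  x-degree≤3 2 _ _ = s≤s (s≤s z≤n)
  x-degree≤3 3 _ _ = s≤s (s≤s (s≤s z≤n))
  -- `coeff` reduces to `0ℙ` only once the row is known, hence a clause for each j.
  x-degree≤3 (suc (suc (suc (suc _)))) 0                   c = contradiction refl c
  x-degree≤3 (suc (suc (suc (suc _)))) 1                   c = contradiction refl c
  x-degree≤3 (suc (suc (suc (suc _)))) 2                   c = contradiction refl c
  x-degree≤3 (suc (suc (suc (suc _)))) (suc (suc (suc _))) c = contradiction refl c

  y-degree≤2 : ∀ i j → coeff annihilator i j ≢ 0ℙ → j ≤ 2
  y-degree≤2 _ 0                   _ = z≤n
  y-degree≤2 _ 1                   _ = s≤s z≤n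
  y-degree≤2 _ 2                   _ = s≤s (s≤s z≤n)
  y-degree≤2 _ (suc (suc (suc _))) c = contradiction refl c

  bounded : ∀ i j → coeff annihilator i j ≢ 0ℙ → i ℕ.+ j ≤ 5
  bounded i j c = ℕₚ.+-mono-≤ (x-degree≤3 i j c) (y-degree≤2 i j c)

-- A zero prefix gives complexity 0 by convention; otherwise minimality applies.
expansionComplexity-≤ : ∀ s N {d} → AnnihilatedInDegree s N d → expansionComplexity s N ≤ d
expansionComplexity-≤ s N {d} ann = case ℕₚ.allUpTo? (λ n → s n ℙₚ.≟ 0ℙ) N of λ where
    (yes zs) → subst (_≤ d) (sym (zeroPrefix λ {n} → zs {n})) z≤n
    (no ¬zs) → IsLeast.minimal (nonZeroPrefix λ zs → ¬zs λ {n} → zs {n}) ann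
  where open IsExpansionComplexity (isExpansionComplexity s N)

corollary3 : ∀ (N : ℕ) → 1 ≤ N → expansionComplexity thueMorse N ≤ 5
corollary3 N _ = expansionComplexity-≤ thueMorse N
  -- `T` is an exact root, so a single polynomial serves modulo every power of x.
  (annihilator , (3 , 2 , λ ()) , annihilator-degree , λ {n} _ → annihilator-T n)
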